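{- For all integers $n\ge 3$ and $1<k<n$, the vertex connectivity of $G=H_B(n,k)$ is $\kappa(G)=1$.
   Context: Fix integers $n\ge 2$ and $1\le k<n$ and positive real numbers $x_1<x_2<\dots<x_n$. Let $\mathscr{B}_n=\{\pm x_1,\pm x_2,\dots,\pm x_{n-1},x_n\}$ (so $-x_n\notin\mathscr{B}_n$). Let $\phi(\mathscr{B}_n)$ be the family of all nonempty subsets $S\subseteq\mathscr{B}_n$ whose elements have pairwise distinct absolute values and whose element of largest absolute value is positive. Let $\mathscr{B}_n^+=\{x_1,\dots,x_n\}$, let $V_1$ be the set of all $k$-element subsets of $\mathscr{B}_n^+$, and let $V_2=\phi(\mathscr{B}_n)\setminus V_1$. For $A\in\phi(\mathscr{B}_n)$ put $A^\dagger=\{|a|:a\in A\}$. The bipartite Kneser B type-$k$ graph $H_B(n,k)$ is the simple graph with vertex set $V_1\cup V_2$ in which $X\in V_1$ and $Y\in V_2$ are adjacent if and only if $X\subseteq Y^\dagger$ or $Y^\dagger\subseteq X$, and there are no other edges. -}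

module Defs where

open import Level using (0ℓ)
open import Data.Nat as ℕ using (ℕ; _∸_)
import Data.Nat.Properties as ℕₚ
open import Data.Rational as ℚ using (ℚ; 0ℚ)
import Data.Rational.Properties as ℚₚ
open import Data.Fin using (Fin; splitAt; inject≤)
open import Data.Fin.Subset as Subset using (Subset; Nonempty)
open import Data.List using (List; length)
open import Data.List.Membership.Propositional using () renaming (_∈_ to _∈ˡ_)
open import Data.List.Relation.Unary.All using (All)
open import Data.List.Relation.Unary.Unique.Propositional using (Unique)
open import Data.Product using (_×_; _,_; proj₁; proj₂; ∃-syntax)
open import Data.Sum using (_⊎_; inj₁; inj₂; [_,_]′; swap)
open import Relation.Binary using (Rel; Symmetric)
open import Relation.Binary.Construct.Closure.ReflexiveTransitive using (Star)
open import Relation.Binary.PropositionalEquality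
  using (_≡_; _≢_; sym; trans; cong; subst; subst₂)
open import Relation.Nullary using (¬_)
open import Relation.Unary using (Pred; _⊆_; _∪_; _∖_)

-- Real numbers as Cauchy sequences of rationals. Distinct sequences may
-- denote the same real: equality of reals is _≈ᵣ_, not _≡_.

Eventually : Pred ℕ 0ℓ → Set
Eventually P = ∃[ N ] (∀ m → N ℕ.≤ m → P m)

Cauchy : (ℕ → ℚ) → Set
Cauchy s = ∀ ε → 0ℚ ℚ.< ε →
  ∃[ N ] (∀ m n → N ℕ.≤ m → N ℕ.≤ n → ℚ.∣ s m ℚ.- s n ∣ ℚ.< ε)

record ℝ : Set where
  constructor mkℝ
  field
    seq    : ℕ → ℚ
    cauchy : Cauchy seq

open ℝ public

infix 4 _≈ᵣ_ _<ᵣ_ _≤ᵣ_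

_≈ᵣ_ : Rel ℝ 0ℓ
x ≈ᵣ y = ∀ ε → 0ℚ ℚ.< ε → Eventually λ m → ℚ.∣ seq x m ℚ.- seq y m ∣ ℚ.< ε

_<ᵣ_ : Rel ℝ 0ℓ
x <ᵣ y = ∃[ ε ] (0ℚ ℚ.< ε × Eventually λ m → seq x m ℚ.+ ε ℚ.≤ seq y m)

_≤ᵣ_ : Rel ℝ 0ℓ
x ≤ᵣ y = ¬ (y <ᵣ x)

0ᵣ : ℝ
0ᵣ = mkℝ (λ _ → 0ℚ) (λ _ 0<ε → 0 , λ _ _ _ _ → 0<ε)

private
  ∣-p--q∣ : ∀ p q → ℚ.∣ (ℚ.- p) ℚ.- (ℚ.- q) ∣ ≡ ℚ.∣ p ℚ.- q ∣
  ∣-p--q∣ p q = trans (cong ℚ.∣_∣ (sym (ℚₚ.neg-distrib-+ p (ℚ.- q))))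
                      (ℚₚ.∣-p∣≡∣p∣ (p ℚ.- q))

  p-q+q : ∀ p q → (p ℚ.- q) ℚ.+ q ≡ p
  p-q+q p q = trans (ℚₚ.+-assoc p (ℚ.- q) q)
             (trans (cong (p ℚ.+_) (ℚₚ.+-inverseˡ q)) (ℚₚ.+-identityʳ p))

  p+q-q : ∀ p q → (p ℚ.+ q) ℚ.- q ≡ p
  p+q-q p q = trans (ℚₚ.+-assoc p q (ℚ.- q))
             (trans (cong (p ℚ.+_) (ℚₚ.+-inverseʳ q)) (ℚₚ.+-identityʳ p))

  -[p-q] : ∀ p q → ℚ.- (p ℚ.- q) ≡ q ℚ.- p
  -[p-q] p q = trans (ℚₚ.neg-distrib-+ p (ℚ.- q))
              (trans (ℚₚ.+-comm (ℚ.- p) (ℚ.- (ℚ.- q)))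
                     (cong (ℚ._- p) (⁻¹-involutive q)))
    where open import Algebra.Properties.Group ℚₚ.+-0-group using (⁻¹-involutive)

  ∣p∣-∣q∣≤∣p-q∣ : ∀ p q → ℚ.∣ p ∣ ℚ.- ℚ.∣ q ∣ ℚ.≤ ℚ.∣ p ℚ.- q ∣
  ∣p∣-∣q∣≤∣p-q∣ p q = subst (ℚ.∣ p ∣ ℚ.- ℚ.∣ q ∣ ℚ.≤_) (p+q-q ℚ.∣ p ℚ.- q ∣ ℚ.∣ q ∣)
    (ℚₚ.+-monoˡ-≤ (ℚ.- ℚ.∣ q ∣)
      (subst (λ r → ℚ.∣ r ∣ ℚ.≤ ℚ.∣ p ℚ.- q ∣ ℚ.+ ℚ.∣ q ∣) (p-q+q p q)
        (ℚₚ.∣p+q∣≤∣p∣+∣q∣ (p ℚ.- q) q)))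

  ∣∣p∣-∣q∣∣≤∣p-q∣ : ∀ p q → ℚ.∣ ℚ.∣ p ∣ ℚ.- ℚ.∣ q ∣ ∣ ℚ.≤ ℚ.∣ p ℚ.- q ∣
  ∣∣p∣-∣q∣∣≤∣p-q∣ p q with ℚₚ.∣p∣≡p∨∣p∣≡-p (ℚ.∣ p ∣ ℚ.- ℚ.∣ q ∣)
  ... | inj₁ eq = subst (ℚ._≤ ℚ.∣ p ℚ.- q ∣) (sym eq) (∣p∣-∣q∣≤∣p-q∣ p q)
  ... | inj₂ eq = subst₂ ℚ._≤_
    (sym (trans eq (-[p-q] ℚ.∣ p ∣ ℚ.∣ q ∣)))
    (trans (cong ℚ.∣_∣ (sym (-[p-q] p q))) (ℚₚ.∣-p∣≡∣p∣ (p ℚ.- q)))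
    (∣p∣-∣q∣≤∣p-q∣ q p)

infix 8 -ᵣ_

-ᵣ_ : ℝ → ℝ
-ᵣ x = mkℝ (λ m → ℚ.- seq x m) λ ε 0<ε → let (N , h) = cauchy x ε 0<ε in
  N , λ m n N≤m N≤n →
    subst (ℚ._< ε) (sym (∣-p--q∣ (seq x m) (seq x n))) (h m n N≤m N≤n)

∣_∣ᵣ : ℝ → ℝ
∣ x ∣ᵣ = mkℝ (λ m → ℚ.∣ seq x m ∣) λ ε 0<ε → let (N , h) = cauchy x ε 0<ε in
  N , λ m n N≤m N≤n →
    ℚₚ.≤-<-trans (∣∣p∣-∣q∣∣≤∣p-q∣ (seq x m) (seq x n)) (h m n N≤m N≤n)

-- The vertices are the elements of U satisfying Vertex.
record SimpleGraph (U : Set) : Set₁ where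
  infix 4 _~_
  field
    Vertex   : Pred U 0ℓ
    _~_      : Rel U 0ℓ
    ~-vertex : ∀ {u v} → u ~ v → Vertex u × Vertex v
    ~-sym    : Symmetric _~_
    ~-irrefl : ∀ {u} → ¬ (u ~ u)

module _ {U : Set} where

  infixl 6 _⟍_

  _⟍_ : SimpleGraph U → List U → SimpleGraph U
  G ⟍ C = record
    { Vertex   = Vertex ∖ (_∈ˡ C)
    ; _~_      = λ u v → u ~ v × ¬ (u ∈ˡ C) × ¬ (v ∈ˡ C)
    ; ~-vertex = λ (e , u∉ , v∉) →
        (proj₁ (~-vertex e) , u∉) , (proj₂ (~-vertex e) , v∉)
    ; ~-sym    = λ (e , u∉ , v∉) → ~-sym e , v∉ , u∉
    ; ~-irrefl = λ (e , _) → ~-irrefl e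
    }
    where open SimpleGraph G

  Connected : SimpleGraph U → Set
  Connected G = ∀ u v → Vertex u → Vertex v → Star _~_ u v
    where open SimpleGraph G

  Trivial : SimpleGraph U → Set
  Trivial G = ∀ u v → Vertex u → Vertex v → u ≡ v
    where open SimpleGraph G

  -- C lists, without repetition, a set of vertices whose removal leaves a
  -- disconnected graph or a graph with at most one vertex.
  IsVertexCut : SimpleGraph U → List U → Set
  IsVertexCut G C =
    All (SimpleGraph.Vertex G) C × Unique C ×
    (¬ Connected (G ⟍ C) ⊎ Trivial (G ⟍ C))

  -- κ(G) = c, where κ(G) is the least size of a set as above.
  HasVertexConnectivity : SimpleGraph U → ℕ → Set
  HasVertexConnectivity G c =
    (∃[ C ] (IsVertexCut G C × length C ≡ c)) ×
    (∀ C → IsVertexCut G C → c ℕ.≤ length C)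

module KneserB (n k : ℕ) (x : Fin n → ℝ) where

  -- Positions 0 … n-1 list x₁ … xₙ and positions n … 2n-2 list -x₁ … -xₙ₋₁.
  -- When 0 < x₁ < … < xₙ these are pairwise distinct, so that the subsets of
  -- 𝓑ₙ correspond to sets of positions.
  size : ℕ
  size = n ℕ.+ (n ∸ 1)

  b : Fin size → ℝ
  b i = [ x , (λ j → -ᵣ x (inject≤ j (ℕₚ.m∸n≤m n 1))) ]′ (splitAt n i)

  ⟦_⟧ : Subset size → Pred ℝ 0ℓ
  ⟦ S ⟧ r = ∃[ i ] (i Subset.∈ S × r ≈ᵣ b i)

  _† : Subset size → Pred ℝ 0ℓ
  (A †) r = ∃[ i ] (i Subset.∈ A × r ≈ᵣ ∣ b i ∣ᵣ)

  𝓑⁺ : Pred ℝ 0ℓ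
  𝓑⁺ r = ∃[ i ] (r ≈ᵣ x i)

  DistinctAbs : Pred (Subset size) 0ℓ
  DistinctAbs S = ∀ i j → i Subset.∈ S → j Subset.∈ S →
    i ≢ j → ¬ (∣ b i ∣ᵣ ≈ᵣ ∣ b j ∣ᵣ)

  LargestPositive : Pred (Subset size) 0ℓ
  LargestPositive S = ∀ i → i Subset.∈ S →
    (∀ j → j Subset.∈ S → ∣ b j ∣ᵣ ≤ᵣ ∣ b i ∣ᵣ) → 0ᵣ <ᵣ b i

  φ : Pred (Subset size) 0ℓ
  φ S = Nonempty S × DistinctAbs S × LargestPositive S

  V₁ : Pred (Subset size) 0ℓ
  V₁ S = ⟦ S ⟧ ⊆ 𝓑⁺ × Subset.∣ S ∣ ≡ k

  V₂ : Pred (Subset size) 0ℓ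
  V₂ = φ ∖ V₁

  Edge : Rel (Subset size) 0ℓ
  Edge X Y = V₁ X × V₂ Y × (⟦ X ⟧ ⊆ Y † ⊎ Y † ⊆ ⟦ X ⟧)

  H : SimpleGraph (Subset size)
  H = record
    { Vertex   = V₁ ∪ V₂
    ; _~_      = λ u v → Edge u v ⊎ Edge v u
    ; ~-vertex = [ (λ (p , q , _) → inj₁ p , inj₂ q)
                 , (λ (p , q , _) → inj₂ q , inj₁ p) ]′
    ; ~-sym    = swap
    ; ~-irrefl = [ (λ (p , q , _) → proj₂ q p) , (λ (p , q , _) → proj₂ q p) ]′
    }

H_B : (n k : ℕ) (x : Fin n → ℝ) → SimpleGraph (Subset (n ℕ.+ (n ∸ 1)))
H_B = KneserB.H

{-# OPTIONS --safe #-}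
-- A vertex Y of V₂ whose set of absolute values has exactly k elements is
-- adjacent to that set Y† ∈ V₁ only.  For k > 1 such a Y exists: negate the
-- least element of a k-subset.  So deleting Y† isolates Y.  Conversely 𝓑ₙ⁺
-- itself lies in V₂ because k < n and is adjacent to all of V₁, while every
-- vertex of V₂ has a neighbour in V₁, so the graph is connected.
module Submission where

open import Defs
open import Data.Nat using (ℕ; zero; suc; _≤_; _<_; z≤n; s≤s; _+_; _∸_; _⊔_; _≤?_)
open import Data.Fin as Fin using (Fin; zero; suc; splitAt; inject≤; _↑ˡ_; _↑ʳ_)

open import Level using (0ℓ)
import Data.Nat.Properties as ℕₚ
open import Data.Rational as ℚ using (ℚ; 0ℚ)
import Data.Rational.Properties as ℚₚ
import Data.Fin.Properties as Finₚ
open import Data.Fin.Subset as Subset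
  using (Subset; inside; outside; Nonempty; ∣_∣; _∈_; ⊤; ⊥)
import Data.Fin.Subset.Properties as Subsetₚ
open import Data.List using ([]; _∷_)
open import Data.List.Membership.Propositional using () renaming (_∈_ to _∈ˡ_)
open import Data.List.Relation.Unary.Any using (here)
open import Data.List.Relation.Unary.All using ([]; _∷_)
open import Data.List.Relation.Unary.AllPairs using ([]; _∷_)
open import Data.Product using (_×_; _,_; proj₁; proj₂; ∃-syntax)
open import Data.Sum using (_⊎_; inj₁; inj₂; [_,_]′)
open import Data.Vec using ([]; _∷_; _++_; here; there) renaming (splitAt to splitAtⱽ)
import Data.Vec.Properties as Vecₚ
open import Relation.Binary using (tri<; tri≈; tri>)
open import Relation.Binary.Construct.Closure.ReflexiveTransitive as Star
  using (Star; _◅_; _◅◅_; reverse)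
open import Relation.Binary.PropositionalEquality
  using (_≡_; _≢_; refl; sym; trans; cong; subst; subst₂; module ≡-Reasoning)
open import Relation.Nullary.Decidable using (_×-dec_)
open import Relation.Nullary using (¬_; yes; no; contradiction)
open import Relation.Unary as U using (Pred)

-- Real numbers

infix 4 _≐_

-- Termwise equality from some index on. It is stronger than `_≈ᵣ_` and holds between a positive
-- real and its absolute value; both `_≈ᵣ_` and `_<ᵣ_` transport along it without splitting any ε.
_≐_ : ℝ → ℝ → Set
y ≐ z = Eventually λ m → seq y m ≡ seq z m

eventually-× : {P Q : Pred ℕ 0ℓ} → Eventually P → Eventually Q → Eventually (P U.∩ Q)
eventually-× (M , p) (N , q) = M ⊔ N , λ m M⊔N≤m →
  p m (ℕₚ.≤-trans (ℕₚ.m≤m⊔n M N) M⊔N≤m) , q m (ℕₚ.≤-trans (ℕₚ.m≤n⊔m M N) M⊔N≤m)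

eventually-map : {P Q : Pred ℕ 0ℓ} → (∀ m → P m → Q m) → Eventually P → Eventually Q
eventually-map f (N , p) = N , λ m N≤m → f m (p m N≤m)

≐-sym : ∀ y z → y ≐ z → z ≐ y
≐-sym y z = eventually-map λ _ → sym

≈-refl : ∀ y → y ≈ᵣ y
≈-refl y ε 0<ε = 0 , λ m _ → subst (ℚ._< ε) (sym (cong ℚ.∣_∣ (ℚₚ.+-inverseʳ (seq y m)))) 0<ε

≈-reflexive : ∀ {y z} → y ≡ z → y ≈ᵣ z
≈-reflexive {y} refl = ≈-refl y

≈-respʳ : ∀ y {z z′} → z ≐ z′ → y ≈ᵣ z → y ≈ᵣ z′
≈-respʳ y z≐z′ y≈z ε 0<ε = eventually-map
  (λ m (eq , lt) → subst (λ q → ℚ.∣ seq y m ℚ.- q ∣ ℚ.< ε) eq lt)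
  (eventually-× z≐z′ (y≈z ε 0<ε))

≈-respˡ : ∀ {y y′} z → y ≐ y′ → y ≈ᵣ z → y′ ≈ᵣ z
≈-respˡ z y≐y′ y≈z ε 0<ε = eventually-map
  (λ m (eq , lt) → subst (λ q → ℚ.∣ q ℚ.- seq z m ∣ ℚ.< ε) eq lt)
  (eventually-× y≐y′ (y≈z ε 0<ε))

<-resp-≐ : ∀ {y y′ z z′} → y ≐ y′ → z ≐ z′ → y <ᵣ z → y′ <ᵣ z′
<-resp-≐ y≐y′ z≐z′ (ε , 0<ε , y+ε≤z) = ε , 0<ε , eventually-map
  (λ _ (eq , eq′ , le) → subst₂ (λ p q → p ℚ.+ ε ℚ.≤ q) eq eq′ le)
  (eventually-× y≐y′ (eventually-× z≐z′ y+ε≤z))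

p+ε≤q⇒ε≤q-p : ∀ p q ε → p ℚ.+ ε ℚ.≤ q → ε ℚ.≤ q ℚ.- p
p+ε≤q⇒ε≤q-p p q ε p+ε≤q = subst (ℚ._≤ q ℚ.- p) p+ε-p≡ε (ℚₚ.+-monoˡ-≤ (ℚ.- p) p+ε≤q)
  where
  open ≡-Reasoning
  p+ε-p≡ε : (p ℚ.+ ε) ℚ.- p ≡ ε
  p+ε-p≡ε = begin
    (p ℚ.+ ε) ℚ.- p ≡⟨ cong (ℚ._- p) (ℚₚ.+-comm p ε) ⟩
    (ε ℚ.+ p) ℚ.- p ≡⟨ ℚₚ.+-assoc ε p (ℚ.- p) ⟩
    ε ℚ.+ (p ℚ.- p) ≡⟨ cong (ε ℚ.+_) (ℚₚ.+-inverseʳ p) ⟩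
    ε ℚ.+ 0ℚ        ≡⟨ ℚₚ.+-identityʳ ε ⟩
    ε               ∎

-- The gap ε that witnesses `y <ᵣ z` is itself a tolerance at which closeness fails: at a late
-- enough index ε ≤ z - y = |z - y| < ε.
<⇒≉˘ : ∀ {y z} → y <ᵣ z → ¬ (z ≈ᵣ y)
<⇒≉˘ {y} {z} (ε , 0<ε , y+ε≤z) z≈y with eventually-× y+ε≤z (z≈y ε 0<ε)
... | N , h with h N ℕₚ.≤-refl
... | le , lt = ℚₚ.<-irrefl refl (ℚₚ.≤-<-trans (subst (ε ℚ.≤_) (sym ∣z-y∣≡z-y) ε≤z-y) lt)
  where
  ε≤z-y = p+ε≤q⇒ε≤q-p (seq y N) (seq z N) ε le
  ∣z-y∣≡z-y = ℚₚ.0≤p⇒∣p∣≡p (ℚₚ.≤-trans (ℚₚ.<⇒≤ 0<ε) ε≤z-y)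

∣p-q∣≡∣q-p∣ : ∀ p q → ℚ.∣ p ℚ.- q ∣ ≡ ℚ.∣ q ℚ.- p ∣
∣p-q∣≡∣q-p∣ p q = trans (sym (ℚₚ.∣-p∣≡∣p∣ (p ℚ.- q))) (cong ℚ.∣_∣ (⁻¹-anti-homo-// p q))
  where open import Algebra.Properties.Group ℚₚ.+-0-group using (⁻¹-anti-homo-//)

≈-sym : ∀ {y z} → y ≈ᵣ z → z ≈ᵣ y
≈-sym {y} {z} y≈z ε 0<ε = eventually-map
  (λ m → subst (ℚ._< ε) (∣p-q∣≡∣q-p∣ (seq y m) (seq z m))) (y≈z ε 0<ε)

<⇒≉ : ∀ {y z} → y <ᵣ z → ¬ (y ≈ᵣ z)
<⇒≉ {y} {z} y<z y≈z = <⇒≉˘ {y} {z} y<z (≈-sym {y} {z} y≈z)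

eventually-nonneg : ∀ {y} → 0ᵣ <ᵣ y → Eventually λ m → 0ℚ ℚ.≤ seq y m
eventually-nonneg (ε , 0<ε , 0+ε≤y) = eventually-map
  (λ m le → ℚₚ.≤-trans (ℚₚ.<⇒≤ 0<ε) (subst (ℚ._≤ _) (ℚₚ.+-identityˡ ε) le)) 0+ε≤y

∣pos∣ : ∀ {y} → 0ᵣ <ᵣ y → ∣ y ∣ᵣ ≐ y
∣pos∣ {y} 0<y = eventually-map (λ _ → ℚₚ.0≤p⇒∣p∣≡p) (eventually-nonneg {y} 0<y)

∣-pos∣ : ∀ {y} → 0ᵣ <ᵣ y → ∣ -ᵣ y ∣ᵣ ≐ y
∣-pos∣ {y} 0<y = eventually-map (λ m → trans (ℚₚ.∣-p∣≡∣p∣ (seq y m))) (∣pos∣ {y} 0<y)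

-pos<pos : ∀ {y z} → 0ᵣ <ᵣ y → 0ᵣ <ᵣ z → -ᵣ y <ᵣ z
-pos<pos {y} 0<y (ε , 0<ε , 0+ε≤z) = ε , 0<ε , eventually-map
  (λ m (0≤y , le) → ℚₚ.≤-trans (ℚₚ.+-monoˡ-≤ ε (ℚₚ.neg-antimono-≤ 0≤y)) le)
  (eventually-× (eventually-nonneg {y} 0<y) 0+ε≤z)

-- Finite subsets

module _ {m n : ℕ} where

  ∈-++⁺ˡ : ∀ {p : Subset m} {q : Subset n} {i} → i ∈ p → i ↑ˡ n ∈ p ++ q
  ∈-++⁺ˡ {p} {q} {i} i∈p = Vecₚ.lookup⇒[]= (i ↑ˡ n) (p ++ q)
    (trans (Vecₚ.lookup-++ˡ p q i) (Vecₚ.[]=⇒lookup i∈p))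

  ∈-++⁻ˡ : ∀ {p : Subset m} {q : Subset n} {i} → i ↑ˡ n ∈ p ++ q → i ∈ p
  ∈-++⁻ˡ {p} {q} {i} i∈p++q = Vecₚ.lookup⇒[]= i p
    (trans (sym (Vecₚ.lookup-++ˡ p q i)) (Vecₚ.[]=⇒lookup i∈p++q))

  ∈-++⁺ʳ : ∀ {p : Subset m} {q : Subset n} {i} → i ∈ q → m ↑ʳ i ∈ p ++ q
  ∈-++⁺ʳ {p} {q} {i} i∈q = Vecₚ.lookup⇒[]= (m ↑ʳ i) (p ++ q)
    (trans (Vecₚ.lookup-++ʳ p q i) (Vecₚ.[]=⇒lookup i∈q))

  ∈-++⁻ʳ : ∀ {p : Subset m} {q : Subset n} {i} → m ↑ʳ i ∈ p ++ q → i ∈ q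
  ∈-++⁻ʳ {p} {q} {i} i∈p++q = Vecₚ.lookup⇒[]= i q
    (trans (sym (Vecₚ.lookup-++ʳ p q i)) (Vecₚ.[]=⇒lookup i∈p++q))

  -- A view: matching on it puts an index in embedded form, where the membership lemmas for `++`
  -- apply.
  data Split : Fin (m + n) → Set where
    left  : ∀ i → Split (i ↑ˡ n)
    right : ∀ i → Split (m ↑ʳ i)

  split : ∀ i → Split i
  split i with splitAt m i in eq
  ... | inj₁ j = subst Split (Finₚ.splitAt⁻¹-↑ˡ eq) (left j)
  ... | inj₂ j = subst Split (Finₚ.splitAt⁻¹-↑ʳ eq) (right j)

∣p++⊥∣≡∣p∣ : ∀ {m} n (p : Subset m) → ∣ p ++ ⊥ {n} ∣ ≡ ∣ p ∣
∣p++⊥∣≡∣p∣ n []            = Subsetₚ.∣⊥∣≡0 n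
∣p++⊥∣≡∣p∣ n (inside  ∷ p) = cong suc (∣p++⊥∣≡∣p∣ n p)
∣p++⊥∣≡∣p∣ n (outside ∷ p) = ∣p++⊥∣≡∣p∣ n p

p⊆q∧∣p∣≡∣q∣⇒p≡q : ∀ {n} {p q : Subset n} → p Subset.⊆ q → ∣ p ∣ ≡ ∣ q ∣ → p ≡ q
p⊆q∧∣p∣≡∣q∣⇒p≡q {p = p} {q} p⊆q ∣p∣≡∣q∣ = Subsetₚ.⊆-antisym p⊆q q⊆p
  where
  q⊆p : q Subset.⊆ p
  q⊆p {i} i∈q with i Subsetₚ.∈? p
  ... | yes i∈p = i∈p
  ... | no  i∉p = contradiction ∣p∣≡∣q∣ (ℕₚ.<⇒≢ (Subsetₚ.p⊂q⇒∣p∣<∣q∣ (p⊆q , i , i∈q , i∉p)))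

∣p∣>0⇒Nonempty : ∀ {n} (p : Subset n) → 0 < ∣ p ∣ → Nonempty p
∣p∣>0⇒Nonempty {n} p 0<∣p∣ with Subsetₚ.nonempty? p
... | yes ne    = ne
... | no  empty = contradiction
  (trans (cong ∣_∣ (Subsetₚ.Empty-unique empty)) (Subsetₚ.∣⊥∣≡0 n)) (ℕₚ.>⇒≢ 0<∣p∣)

-- A greedy choice: keep indices satisfying `P`, and skip the others as long as enough indices
-- remain. The set ends up inside `P` if at least k indices satisfy `P`, and contains `P` otherwise.
∃-comparable : ∀ {n} {P : Pred (Fin n) 0ℓ} → U.Decidable P → ∀ k → k ≤ n →
  ∃[ p ] (∣ p ∣ ≡ k × ((∀ {i} → i ∈ p → P i) ⊎ (∀ {i} → P i → i ∈ p)))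
∃-comparable {n} P? zero _ = ⊥ , Subsetₚ.∣⊥∣≡0 n , inj₁ λ i∈⊥ → contradiction i∈⊥ Subsetₚ.∉⊥
∃-comparable {suc n} P? (suc k) (s≤s k≤n) with P? zero
∃-comparable {suc n} P? (suc k) (s≤s k≤n) | yes P0
  with ∃-comparable (λ i → P? (suc i)) k k≤n
... | p , ∣p∣≡k , inj₁ p⊆P = inside ∷ p , cong suc ∣p∣≡k ,
  inj₁ λ { here → P0 ; (there i∈p) → p⊆P i∈p }
... | p , ∣p∣≡k , inj₂ P⊆p = inside ∷ p , cong suc ∣p∣≡k ,
  inj₂ λ { {zero} _ → here ; {suc i} Pi → there (P⊆p Pi) }
∃-comparable {suc n} P? (suc k) (s≤s k≤n) | no ¬P0 with suc k ≤? n
-- Skipping index 0 would leave too few indices: here `k` equals the length of the tail, so only the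
-- full set has size `suc k`.
... | no  k≮n = ⊤ , trans (Subsetₚ.∣⊤∣≡n (suc n)) (cong suc (ℕₚ.≤-antisym (ℕₚ.≮⇒≥ k≮n) k≤n)) ,
  inj₂ λ _ → Subsetₚ.∈⊤
... | yes k<n with ∃-comparable (λ i → P? (suc i)) (suc k) k<n
... | p , ∣p∣≡k , inj₁ p⊆P = outside ∷ p , ∣p∣≡k , inj₁ λ { (there i∈p) → p⊆P i∈p }
... | p , ∣p∣≡k , inj₂ P⊆p = outside ∷ p , ∣p∣≡k ,
  inj₂ λ { {zero} P0 → contradiction P0 ¬P0 ; {suc i} Pi → there (P⊆p Pi) }

-- The graph H_B(n, k)

module Positions (n k : ℕ) (x : Fin n → ℝ)
  (0<x : ∀ i → 0ᵣ <ᵣ x i) (x-mono : ∀ i j → i Fin.< j → x i <ᵣ x j) where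

  open KneserB n k x public
  open SimpleGraph H public using (Vertex; _~_)

  x-injective : ∀ i j → x i ≈ᵣ x j → i ≡ j
  x-injective i j xᵢ≈xⱼ with Finₚ.<-cmp i j
  ... | tri< i<j _ _ = contradiction xᵢ≈xⱼ (<⇒≉ {x i} {x j} (x-mono i j i<j))
  ... | tri≈ _ i≡j _ = i≡j
  ... | tri> _ _ j<i = contradiction xᵢ≈xⱼ (<⇒≉˘ {x j} {x i} (x-mono j i j<i))

  -- The index of the absolute value at a position. As each `x j` is positive, `∣ b i ∣ᵣ` agrees
  -- eventually with `x (π i)`, so questions about absolute values become questions about indices.
  π : Fin size → Fin n
  π i = [ (λ j → j) , (λ j → inject≤ j (ℕₚ.m∸n≤m n 1)) ]′ (splitAt n i)

  π-↑ˡ : ∀ j → π (j ↑ˡ (n ∸ 1)) ≡ j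
  π-↑ˡ j = cong [ _ , _ ]′ (Finₚ.splitAt-↑ˡ n j (n ∸ 1))

  π-↑ʳ : ∀ j → π (n ↑ʳ j) ≡ inject≤ j (ℕₚ.m∸n≤m n 1)
  π-↑ʳ j = cong [ _ , _ ]′ (Finₚ.splitAt-↑ʳ n (n ∸ 1) j)

  b-↑ˡ : ∀ j → b (j ↑ˡ (n ∸ 1)) ≡ x j
  b-↑ˡ j = cong [ x , _ ]′ (Finₚ.splitAt-↑ˡ n j (n ∸ 1))

  b-↑ʳ : ∀ j → b (n ↑ʳ j) ≡ -ᵣ x (inject≤ j (ℕₚ.m∸n≤m n 1))
  b-↑ʳ j = cong [ x , _ ]′ (Finₚ.splitAt-↑ʳ n (n ∸ 1) j)

  ∣b∣≐x∘π : ∀ i → ∣ b i ∣ᵣ ≐ x (π i)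
  ∣b∣≐x∘π i with splitAt n i
  ... | inj₁ j = ∣pos∣ {x j} (0<x j)
  ... | inj₂ j = ∣-pos∣ {x (inject≤ j (ℕₚ.m∸n≤m n 1))} (0<x _)

  x∘π≐∣b∣ : ∀ i → x (π i) ≐ ∣ b i ∣ᵣ
  x∘π≐∣b∣ i = ≐-sym ∣ b i ∣ᵣ (x (π i)) (∣b∣≐x∘π i)

  ≈∣b∣⇒≈x : ∀ {r} i → r ≈ᵣ ∣ b i ∣ᵣ → r ≈ᵣ x (π i)
  ≈∣b∣⇒≈x {r} i = ≈-respʳ r {∣ b i ∣ᵣ} {x (π i)} (∣b∣≐x∘π i)

  ≈x⇒≈∣b∣ : ∀ {r} i j → π i ≡ j → r ≈ᵣ x j → r ≈ᵣ ∣ b i ∣ᵣ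
  ≈x⇒≈∣b∣ {r} i _ refl = ≈-respʳ r {x (π i)} {∣ b i ∣ᵣ} (x∘π≐∣b∣ i)

  ∣b∣<∣b∣ : ∀ i j → π i Fin.< π j → ∣ b i ∣ᵣ <ᵣ ∣ b j ∣ᵣ
  ∣b∣<∣b∣ i j πi<πj = <-resp-≐ {x (π i)} {∣ b i ∣ᵣ} {x (π j)} {∣ b j ∣ᵣ}
    (x∘π≐∣b∣ i) (x∘π≐∣b∣ j) (x-mono _ _ πi<πj)

  π-injective⇒DistinctAbs : ∀ {S} → (∀ i j → i ∈ S → j ∈ S → π i ≡ π j → i ≡ j) → DistinctAbs S
  π-injective⇒DistinctAbs inj i j i∈S j∈S i≢j eq = i≢j (inj i j i∈S j∈S
    (x-injective _ _ (≈-respˡ {∣ b i ∣ᵣ} {x (π i)} (x (π j)) (∣b∣≐x∘π i)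
      (≈∣b∣⇒≈x {∣ b i ∣ᵣ} j eq))))

  positive : Subset n → Subset size
  positive p = p ++ ⊥

  0<b-↑ˡ : ∀ j → 0ᵣ <ᵣ b (j ↑ˡ (n ∸ 1))
  0<b-↑ˡ j = subst (0ᵣ <ᵣ_) (sym (b-↑ˡ j)) (0<x j)

  ∈-positive⁻ : ∀ {p i} → i ∈ positive p → ∃[ j ] (i ≡ j ↑ˡ (n ∸ 1) × j ∈ p)
  ∈-positive⁻ {p} {i} i∈ with split {n} {n ∸ 1} i
  ... | left  j = j , refl , ∈-++⁻ˡ i∈
  ... | right j = contradiction (∈-++⁻ʳ {p = p} i∈) Subsetₚ.∉⊥

  positive-V₁ : ∀ {p} → ∣ p ∣ ≡ k → V₁ (positive p)
  positive-V₁ {p} ∣p∣≡k = (λ {r} → ⊆𝓑⁺ {r}) , trans (∣p++⊥∣≡∣p∣ (n ∸ 1) p) ∣p∣≡k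
    where
    ⊆𝓑⁺ : ⟦ positive p ⟧ U.⊆ 𝓑⁺
    ⊆𝓑⁺ {r} (i , i∈ , r≈bᵢ) with ∈-positive⁻ {p} i∈
    ... | j , refl , _ = j , subst (r ≈ᵣ_) (b-↑ˡ j) r≈bᵢ

  -- The value at a negative position lies strictly below every `x i`, hence denotes no element of
  -- `𝓑⁺`.
  negative∉V₁ : ∀ {S j} → n ↑ʳ j ∈ S → ¬ V₁ S
  negative∉V₁ {S} {j} -j∈S (S⊆𝓑⁺ , _) with S⊆𝓑⁺ {b (n ↑ʳ j)} (n ↑ʳ j , -j∈S , ≈-refl (b (n ↑ʳ j)))
  ... | i , bⱼ≈xᵢ = <⇒≉ {y} {x i} (-pos<pos {x _} {x i} (0<x _) (0<x i))
                        (subst (_≈ᵣ x i) (b-↑ʳ j) bⱼ≈xᵢ)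
    where y = -ᵣ x (inject≤ j (ℕₚ.m∸n≤m n 1))

  -- With negative positions excluded, the second block of `S` is empty. This normal form reduces
  -- the comparison of vertices in `V₁` to that of k-subsets of `Fin n`.
  V₁⇒positive : ∀ {S} → V₁ S → ∃[ p ] (S ≡ positive p × ∣ p ∣ ≡ k)
  V₁⇒positive {S} V₁S@(_ , ∣S∣≡k) with splitAtⱽ n S
  ... | p , q , refl = p , S≡p++⊥ ,
    trans (sym (trans (cong ∣_∣ S≡p++⊥) (∣p++⊥∣≡∣p∣ (n ∸ 1) p))) ∣S∣≡k
    where
    q-empty : Subset.Empty q
    q-empty (j , j∈q) = negative∉V₁ {p ++ q} {j} (∈-++⁺ʳ {p = p} j∈q) V₁S
    S≡p++⊥ : p ++ q ≡ p ++ ⊥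
    S≡p++⊥ = cong (p ++_) (Subsetₚ.Empty-unique q-empty)

  -- The vertex 𝓑ₙ⁺, the hub for all connecting walks.
  top : Subset size
  top = positive ⊤

  -- Connectedness through the hub

  module _ (k<n : k < n) where

    top∉V₁ : ¬ V₁ top
    top∉V₁ V₁top with V₁⇒positive V₁top
    ... | p , eq , ∣p∣≡k = ℕₚ.<⇒≢ k<n (trans (sym ∣p∣≡k)
      (trans (cong ∣_∣ (sym (Vecₚ.++-injectiveˡ ⊤ p eq))) (Subsetₚ.∣⊤∣≡n n)))

    top∈V₂ : V₂ top
    top∈V₂ = (nonempty , π-injective⇒DistinctAbs inj , largest) , top∉V₁
      where
      nonempty : Nonempty top
      nonempty = Fin.fromℕ< (ℕₚ.≤-trans (s≤s z≤n) k<n) ↑ˡ (n ∸ 1) , ∈-++⁺ˡ Subsetₚ.∈⊤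

      inj : ∀ i j → i ∈ top → j ∈ top → π i ≡ π j → i ≡ j
      inj i j i∈ j∈ πi≡πj with ∈-positive⁻ i∈ | ∈-positive⁻ j∈
      ... | i′ , refl , _ | j′ , refl , _ =
        cong (_↑ˡ (n ∸ 1)) (trans (sym (π-↑ˡ i′)) (trans πi≡πj (π-↑ˡ j′)))

      largest : LargestPositive top
      largest i i∈ _ with ∈-positive⁻ i∈
      ... | j , refl , _ = 0<b-↑ˡ j

    V₁~top : ∀ {X} → V₁ X → X ~ top
    V₁~top {X} V₁X@(X⊆𝓑⁺ , _) = inj₁ (V₁X , top∈V₂ , inj₁ λ {r} → X⊆top† {r})
      where
      X⊆top† : ⟦ X ⟧ U.⊆ top †
      X⊆top† {r} r∈X with X⊆𝓑⁺ {r} r∈X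
      ... | j , r≈xⱼ = j ↑ˡ (n ∸ 1) , ∈-++⁺ˡ {p = ⊤} Subsetₚ.∈⊤ , ≈x⇒≈∣b∣ {r} _ j (π-↑ˡ j) r≈xⱼ

    -- A k-set comparable with the indices of the absolute values of `Y` is taken; the two
    -- directions of inclusion are exactly the two ways of being adjacent.
    V₂-neighbour : ∀ {Y} → V₂ Y → ∃[ X ] (V₁ X × Edge X Y)
    V₂-neighbour {Y} V₂Y with ∃-comparable {P = λ j → ∃[ i ] (i ∈ Y × π i ≡ j)}
        (λ j → Finₚ.any? λ i → (i Subsetₚ.∈? Y) ×-dec (π i Finₚ.≟ j)) k (ℕₚ.<⇒≤ k<n)
    ... | p , ∣p∣≡k , inj₁ p⊆πY =
      positive p , positive-V₁ ∣p∣≡k , positive-V₁ ∣p∣≡k , V₂Y , inj₁ λ {r} → p⊆Y† {r}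
      where
      p⊆Y† : ⟦ positive p ⟧ U.⊆ Y †
      p⊆Y† {r} (i , i∈ , r≈bᵢ) with ∈-positive⁻ {p} i∈
      ... | j , refl , j∈p with p⊆πY j∈p
      ... | i′ , i′∈Y , πi′≡j = i′ , i′∈Y , ≈x⇒≈∣b∣ {r} i′ j πi′≡j (subst (r ≈ᵣ_) (b-↑ˡ j) r≈bᵢ)
    ... | p , ∣p∣≡k , inj₂ πY⊆p =
      positive p , positive-V₁ ∣p∣≡k , positive-V₁ ∣p∣≡k , V₂Y , inj₂ λ {r} → Y†⊆p {r}
      where
      Y†⊆p : Y † U.⊆ ⟦ positive p ⟧
      Y†⊆p {r} (i , i∈Y , r≈∣bᵢ∣) = π i ↑ˡ (n ∸ 1) , ∈-++⁺ˡ (πY⊆p (i , i∈Y , refl)) ,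
        subst (r ≈ᵣ_) (sym (b-↑ˡ (π i))) (≈∣b∣⇒≈x {r} i r≈∣bᵢ∣)

    -- A vertex of `V₁` reaches `top` in one step and a vertex of `V₂` in two, via a neighbour in
    -- `V₁`. The form `H ⟍ C` with memberless `C` is the one that excluding the empty cut requires.
    connected : ∀ {C} → (∀ {u} → ¬ (u ∈ˡ C)) → Connected (H ⟍ C)
    connected ∉C u v u∈ v∈ =
      toTop u (proj₁ u∈) ◅◅ reverse (SimpleGraph.~-sym (H ⟍ _)) (toTop v (proj₁ v∈))
      where
      toTop : ∀ w → Vertex w → Star (SimpleGraph._~_ (H ⟍ _)) w top
      toTop w (inj₁ V₁w) = (V₁~top V₁w , ∉C , ∉C) ◅ Star.ε
      toTop w (inj₂ V₂w) with V₂-neighbour V₂w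
      ... | X , V₁X , edge = (inj₂ edge , ∉C , ∉C) ◅ (V₁~top V₁X , ∉C , ∉C) ◅ Star.ε

  -- The hypotheses say that `p` indexes `Y †`. A neighbour is `positive q` with `q` of size k, and
  -- adjacency makes `p` and `q` comparable; equal sizes then force equality whichever inclusion
  -- holds.
  shadow-pendant : ∀ {Y p} → ∣ p ∣ ≡ k →
    (∀ {i} → i ∈ Y → π i ∈ p) → (∀ {j} → j ∈ p → ∃[ i ] (i ∈ Y × π i ≡ j)) →
    ∀ {Z} → Edge Z Y → Z ≡ positive p
  shadow-pendant {Y} {p} ∣p∣≡k πY⊆p p⊆πY (V₁Z , _ , incl) with V₁⇒positive V₁Z
  shadow-pendant {Y} {p} ∣p∣≡k πY⊆p p⊆πY (V₁Z , _ , inj₁ Z⊆Y†) | q , refl , ∣q∣≡k =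
    cong positive (p⊆q∧∣p∣≡∣q∣⇒p≡q q⊆p (trans ∣q∣≡k (sym ∣p∣≡k)))
    where
    q⊆p : q Subset.⊆ p
    q⊆p {j} j∈q with Z⊆Y† {x j} (j ↑ˡ (n ∸ 1) , ∈-++⁺ˡ j∈q , ≈-reflexive (sym (b-↑ˡ j)))
    ... | i , i∈Y , xⱼ≈∣bᵢ∣ =
      subst (_∈ p) (sym (x-injective j (π i) (≈∣b∣⇒≈x {x j} i xⱼ≈∣bᵢ∣))) (πY⊆p i∈Y)
  shadow-pendant {Y} {p} ∣p∣≡k πY⊆p p⊆πY (V₁Z , _ , inj₂ Y†⊆Z) | q , refl , ∣q∣≡k =
    cong positive (sym (p⊆q∧∣p∣≡∣q∣⇒p≡q p⊆q (trans ∣p∣≡k (sym ∣q∣≡k))))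
    where
    p⊆q : p Subset.⊆ q
    p⊆q {j} j∈p with p⊆πY j∈p
    ... | i , i∈Y , refl with Y†⊆Z {x j} (i , i∈Y , ≈x⇒≈∣b∣ {x j} i j refl (≈-refl (x j)))
    ... | i′ , i′∈Z , xⱼ≈bᵢ′ with ∈-positive⁻ {q} i′∈Z
    ... | j′ , refl , j′∈q =
      subst (_∈ q) (sym (x-injective j j′ (subst (x j ≈ᵣ_) (b-↑ˡ j′) xⱼ≈bᵢ′))) j′∈q

-- A pendant vertex of `V₂`

module _ (m k : ℕ) (x : Fin (suc (suc m)) → ℝ)
  (0<x : ∀ i → 0ᵣ <ᵣ x i) (x-mono : ∀ i j → i Fin.< j → x i <ᵣ x j)
  (p : Subset (suc m)) (p≠∅ : Nonempty p) (∣p∣≡k : ∣ p ∣ ≡ k) where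

  open Positions (suc (suc m)) (suc k) x 0<x x-mono

  -- {-x₁} ∪ { xᵢ₊₂ ∣ i ∈ p }, indexing 𝓑ₙ from 1 and p from 0.
  flipLeast : Subset size
  flipLeast = (outside ∷ p) ++ (inside ∷ ⊥)

  data FlipLeast∋ : Fin size → Set where
    pos : ∀ {j} → j ∈ p → FlipLeast∋ (suc j ↑ˡ suc m)
    neg : FlipLeast∋ (suc (suc m) ↑ʳ zero)

  ∈-flipLeast⁻ : ∀ {i} → i ∈ flipLeast → FlipLeast∋ i
  ∈-flipLeast⁻ {i} i∈ with split {suc (suc m)} {suc m} i
  ... | left  j with ∈-++⁻ˡ {p = outside ∷ p} {q = inside ∷ ⊥} i∈
  ...   | there j∈p = pos j∈p
  ∈-flipLeast⁻ {i} i∈ | right j with ∈-++⁻ʳ {p = outside ∷ p} {q = inside ∷ ⊥} i∈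
  ...   | here = neg
  ...   | there j∈⊥ = contradiction j∈⊥ Subsetₚ.∉⊥

  neg∈flipLeast : suc (suc m) ↑ʳ zero ∈ flipLeast
  neg∈flipLeast = ∈-++⁺ʳ {p = outside ∷ p} here

  pos∈flipLeast : ∀ {j} → j ∈ p → suc j ↑ˡ suc m ∈ flipLeast
  pos∈flipLeast j∈p = ∈-++⁺ˡ {p = outside ∷ p} {q = inside ∷ ⊥} (there j∈p)

  flipLeast∈V₂ : V₂ flipLeast
  flipLeast∈V₂ = ((_ , neg∈flipLeast) , π-injective⇒DistinctAbs inj , largest) ,
                 negative∉V₁ neg∈flipLeast
    where
    inj′ : ∀ {i j} → FlipLeast∋ i → FlipLeast∋ j → π i ≡ π j → i ≡ j
    inj′ (pos {i} _) (pos {j} _) eq =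
      cong (_↑ˡ suc m) (trans (sym (π-↑ˡ (suc i))) (trans eq (π-↑ˡ (suc j))))
    inj′ (pos {i} _) neg eq =
      contradiction (trans (sym (π-↑ˡ (suc i))) (trans eq (π-↑ʳ zero))) λ ()
    inj′ neg (pos {j} _) eq =
      contradiction (trans (sym (π-↑ʳ zero)) (trans eq (π-↑ˡ (suc j)))) λ ()
    inj′ neg neg _ = refl

    inj : ∀ i j → i ∈ flipLeast → j ∈ flipLeast → π i ≡ π j → i ≡ j
    inj i j i∈ j∈ = inj′ (∈-flipLeast⁻ i∈) (∈-flipLeast⁻ j∈)

    largest : LargestPositive flipLeast
    largest i i∈ max with ∈-flipLeast⁻ i∈
    ... | pos {j} _ = 0<b-↑ˡ (suc j)
    -- -x₁ is not of largest absolute value: the nonempty `p` supplies a positive element of larger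
    -- index, contradicting `max`.
    ... | neg = contradiction
      (∣b∣<∣b∣ i (suc j ↑ˡ suc m)
        (subst₂ Fin._<_ (sym (π-↑ʳ zero)) (sym (π-↑ˡ (suc j))) (s≤s z≤n)))
      (max (suc j ↑ˡ suc m) (pos∈flipLeast (proj₂ p≠∅)))
      where j = proj₁ p≠∅

  -- The sign change leaves the absolute values intact: index 0 of `inside ∷ p` comes from -x₁,
  -- every other index from its own positive position.
  flipLeast-pendant : ∀ {Z} → Edge Z flipLeast → Z ≡ positive (inside ∷ p)
  flipLeast-pendant = shadow-pendant (cong suc ∣p∣≡k)
    (λ i∈ → π∈ (∈-flipLeast⁻ i∈))
    λ { here → _ , neg∈flipLeast , π-↑ʳ zero
      ; (there {i = j} j∈p) → _ , pos∈flipLeast j∈p , π-↑ˡ (suc j) }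
    where
    π∈ : ∀ {i} → FlipLeast∋ i → π i ∈ inside ∷ p
    π∈ (pos {j} j∈p) = subst (_∈ inside ∷ p) (sym (π-↑ˡ (suc j))) (there j∈p)
    π∈ neg           = subst (_∈ inside ∷ p) (sym (π-↑ʳ zero)) here

  -- The cut vertex and the value of the connectivity

  module _ (k<n : suc k < suc (suc m)) where

    private
      X : Subset size
      X = positive (inside ∷ p)

      V₁X : V₁ X
      V₁X = positive-V₁ {inside ∷ p} (cong suc ∣p∣≡k)

    V₁≢V₂ : ∀ {S S′} → V₁ S → V₂ S′ → S ≢ S′
    V₁≢V₂ V₁S (_ , S∉V₁) refl = S∉V₁ V₁S

    -- Only the first edge of a walk matters: either it would put `flipLeast` in `V₁`, or it leads
    -- to the pendant's sole neighbour `X`, which is deleted.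
    flipLeast-isolated : ∀ {S} → S ≢ flipLeast →
      ¬ Star (SimpleGraph._~_ (H ⟍ (X ∷ []))) flipLeast S
    flipLeast-isolated S≢Y Star.ε                         = S≢Y refl
    flipLeast-isolated _   ((inj₁ (V₁Y , _) , _) ◅ _)     = proj₂ flipLeast∈V₂ V₁Y
    flipLeast-isolated _   ((inj₂ edge , _ , Z∉[X]) ◅ _) = Z∉[X] (here (flipLeast-pendant edge))

    ¬connected-⟍ : ¬ Connected (H ⟍ (X ∷ []))
    -- `top` contains position 0, that of x₁, and `flipLeast` does not; the empty match separates
    -- them on this first entry.
    ¬connected-⟍ conn = flipLeast-isolated (λ ()) (conn flipLeast top
      (inj₂ flipLeast∈V₂ , λ { (here eq) → V₁≢V₂ V₁X flipLeast∈V₂ (sym eq) })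
      (inj₂ (top∈V₂ k<n) , λ { (here eq) → V₁≢V₂ V₁X (top∈V₂ k<n) (sym eq) }))

    cut : IsVertexCut H (X ∷ [])
    cut = inj₁ V₁X ∷ [] , [] ∷ [] , inj₁ ¬connected-⟍

    -- This is the whole lower bound, since every other list has length at least 1. The graph is
    -- connected, and it is not trivial because `X` and `top` lie in different classes.
    []-not-cut : ¬ IsVertexCut H []
    []-not-cut (_ , _ , inj₁ ¬conn)   = ¬conn (connected k<n λ ())
    []-not-cut (_ , _ , inj₂ trivial) =
      V₁≢V₂ V₁X (top∈V₂ k<n) (trivial X top (inj₁ V₁X , λ ()) (inj₂ (top∈V₂ k<n) , λ ()))

    connectivity-1 : HasVertexConnectivity H 1
    connectivity-1 = (X ∷ [] , cut , refl) , λ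
      { []      isCut → contradiction isCut []-not-cut
      ; (_ ∷ _) _     → s≤s z≤n }

mainTheorem6 : (n k : ℕ) → 3 ≤ n → 1 < k → k < n →
    (x : Fin n → ℝ) →
    (∀ i → 0ᵣ <ᵣ x i) →
    (∀ i j → i Fin.< j → x i <ᵣ x j) →
    HasVertexConnectivity (H_B n k x) 1
mainTheorem6 (suc (suc m)) (suc k) _ (s≤s 0<k) k<n@(s≤s k<1+m) x 0<x x-mono =
  -- `p` is to hold the `k` elements other than x₁ in a set of size `suc k`. The predicate is
  -- inhabited by the index itself, so `yes` decides it and only the size of the resulting set is
  -- kept.
  let p , ∣p∣≡k , _ = ∃-comparable {P = λ _ → Fin (suc m)} yes k (ℕₚ.<⇒≤ k<1+m)
      p≠∅ = ∣p∣>0⇒Nonempty p (subst (0 <_) (sym ∣p∣≡k) 0<k)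
  in connectivity-1 m k x 0<x x-mono p p≠∅ ∣p∣≡k k<n
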